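{- Let $\alpha_i\ge 0$, $\beta_i>0$ ($1\le i\le 5$) and $Q>0$ be real numbers, and consider the networks $N$ and $N^+$ with these parameters and total flow $Q$. Braess' paradox may occur in $N/N^+$ in the following cases only; that is, if $T^+_{Eq}>T_{Eq}$, then one of the following holds: (a) at equilibria, both $N$ and $N^+$ have no paths with vanishing flow; (b) at equilibria, $N$ has no path with vanishing flow, and $P_3$ is the only path with non-vanishing flow in $N^+$; (c) at equilibria, $N$ has no path with vanishing flow, and $P_1$ is the only path with vanishing flow in $N^+$; (d) at equilibria, $N$ has no path with vanishing flow, and $P_2$ is the only path with vanishing flow in $N^+$.
   Context: The network $N^+$ has nodes $a,b,c,d$ and directed links $(a,b),(b,d),(b,c),(a,c),(c,d)$ with travel times $\alpha_1+\beta_1f_{ab}$, $\alpha_2+\beta_2f_{bd}$, $\alpha_3+\beta_3f_{bc}$, $\alpha_4+\beta_4f_{ac}$, $\alpha_5+\beta_5f_{cd}$ respectively, where $f_{ij}\ge 0$ is the (real) flow on link $(i,j)$ and $\alpha_i\ge 0$, $\beta_i>0$. All traffic, of total amount $Q>0$ (real), goes from $a$ to $d$ along the paths $P_1=a-b-d$, $P_2=a-c-d$, $P_3=a-b-c-d$. The network $N$ is $N^+$ with the link $(b,c)$ removed, so its paths are $P_1,P_2$ only. A flow assigns a non-negative real amount to each path, with total $Q$; the flow on a link is the sum of the flows of the paths containing it; the travel time on a path is the sum of the travel times of its links. A path has vanishing flow if its path flow is $0$, and non-vanishing flow otherwise. A network is at equilibrium if all paths with non-vanishing flow have the same travel time,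 and every path with vanishing flow has travel time at least this common value. The equilibrium exists and is unique; its common travel time is denoted $T_{Eq}$ for $N$ and $T^+_{Eq}$ for $N^+$. Braess' paradox is said to occur in $N/N^+$ for the total flow $Q$ if $T^+_{Eq}>T_{Eq}$. -}

module Defs where

open import Algebra.Bundles using (CommutativeRing)
open import Data.Fin.Base using (Fin)
open import Data.Fin.Patterns using (0F; 1F; 2F; 3F; 4F)
open import Data.Fin.Properties using (_≟_)
open import Data.List.Base using (List; []; _∷_; map; filter; foldr)
open import Data.List.Membership.DecPropositional (_≟_ {5}) using (_∈?_)
open import Data.Product.Base using (∃; _×_)
open import Level using (Level; _⊔_; suc)
open import Relation.Binary.Core using (Rel)
open import Relation.Binary.PropositionalEquality.Core using (_≡_)
open import Relation.Binary.Structures using (IsDecTotalOrder)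
import Relation.Binary.Construct.NonStrictToStrict as NonStrictToStrict
open import Relation.Nullary.Negation.Core using (¬_)
open import Relation.Unary using (Pred; Satisfiable)

-- The standard library has no real numbers.  They are given here by their
-- usual classical axioms, as a Dedekind-complete totally ordered field, which
-- determine ℝ up to isomorphism.  The order is decidable because the reals of
-- the theorem are the classical ones.
record RealNumbers c ℓ₁ ℓ₂ : Set (suc (c ⊔ ℓ₁ ⊔ ℓ₂)) where
  field
    commutativeRing : CommutativeRing c ℓ₁

  open CommutativeRing commutativeRing public

  infix 4 _≤_ _<_

  field
    _≤_             : Rel Carrier ℓ₂
    isDecTotalOrder : IsDecTotalOrder _≈_ _≤_
    0≉1             : ¬ 0# ≈ 1#
    inverse         : ∀ x → ¬ x ≈ 0# → ∃ λ y → x * y ≈ 1#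
    +-monoˡ-≤       : ∀ z {x y} → x ≤ y → x + z ≤ y + z
    *-nonNeg        : ∀ {x y} → 0# ≤ x → 0# ≤ y → 0# ≤ x * y

  _<_ : Rel Carrier (ℓ₁ ⊔ ℓ₂)
  _<_ = NonStrictToStrict._<_ _≈_ _≤_

  UpperBound : ∀ {p} → Pred Carrier p → Carrier → Set (c ⊔ ℓ₂ ⊔ p)
  UpperBound S u = ∀ x → S x → x ≤ u

  field
    complete : (S : Pred Carrier (c ⊔ ℓ₁ ⊔ ℓ₂)) →
               Satisfiable S → ∃ (UpperBound S) →
               ∃ λ s → UpperBound S s × (∀ u → UpperBound S u → s ≤ u)

-- Links are numbered so that αᵢ, βᵢ (1 ≤ i ≤ 5) belong to the link with
-- index i - 1.
Link : Set
Link = Fin 5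

pattern ab = 0F
pattern bd = 1F
pattern bc = 2F
pattern ac = 3F
pattern cd = 4F

data Network : Set where
  N N⁺ : Network

-- The directed paths from a to d.  Removing the link (b,c) from N⁺ leaves
-- only P₁ and P₂.
data Path : Network → Set where
  P₁ P₂ : ∀ {n} → Path n
  P₃    : Path N⁺

paths : ∀ n → List (Path n)
paths N  = P₁ ∷ P₂ ∷ []
paths N⁺ = P₁ ∷ P₂ ∷ P₃ ∷ []

links : ∀ {n} → Path n → List Link
links P₁ = ab ∷ bd ∷ []
links P₂ = ac ∷ cd ∷ []
links P₃ = ab ∷ bc ∷ cd ∷ []

module Flows {c ℓ₁ ℓ₂} (ℝ : RealNumbers c ℓ₁ ℓ₂)
             (α β : Link → RealNumbers.Carrier ℝ)
             (Q : RealNumbers.Carrier ℝ) where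

  open RealNumbers ℝ

  sum : List Carrier → Carrier
  sum = foldr _+_ 0#

  PathFlows : Network → Set c
  PathFlows n = Path n → Carrier

  record IsFlow {n} (f : PathFlows n) : Set (ℓ₁ ⊔ ℓ₂) where
    field
      nonNeg : ∀ p → 0# ≤ f p
      total  : sum (map f (paths n)) ≈ Q

  linkFlow : ∀ {n} → PathFlows n → Link → Carrier
  linkFlow {n} f l = sum (map f (filter (λ p → l ∈? links p) (paths n)))

  linkTime : ∀ {n} → PathFlows n → Link → Carrier
  linkTime f l = α l + β l * linkFlow f l

  pathTime : ∀ {n} → PathFlows n → Path n → Carrier
  pathTime f p = sum (map (linkTime f) (links p))

  Vanishing NonVanishing : ∀ {n} → PathFlows n → Path n → Set ℓ₁
  Vanishing f p    = f p ≈ 0#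
  NonVanishing f p = ¬ Vanishing f p

  -- f is an equilibrium with common travel time T.  When Q > 0 some path has
  -- non-vanishing flow, so T is determined by f.
  record IsEquilibrium {n} (f : PathFlows n) (T : Carrier) : Set (ℓ₁ ⊔ ℓ₂) where
    field
      isFlow       : IsFlow f
      nonVanishing : ∀ p → NonVanishing f p → pathTime f p ≈ T
      vanishing    : ∀ p → Vanishing f p → T ≤ pathTime f p

  NoVanishing : ∀ {n} → PathFlows n → Set ℓ₁
  NoVanishing f = ∀ p → NonVanishing f p

  OnlyVanishing OnlyNonVanishing : ∀ {n} → PathFlows n → Path n → Set ℓ₁
  OnlyVanishing f p    = Vanishing f p × (∀ q → Vanishing f q → q ≡ p)
  OnlyNonVanishing f p = NonVanishing f p × (∀ q → NonVanishing f q → q ≡ p)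

{-# OPTIONS --safe #-}
-- Travel times increase with the flow, and T⁺ is at most the travel time of
-- every path of N⁺.  So if a path is used in N at equilibrium, and none of its
-- links carries more flow in N⁺ than in N, then T⁺ ≤ T.  This applies to the
-- only used path of N when the other one has vanishing flow, for then all of
-- its links carry the full amount Q; and, when P₃ has vanishing flow in N⁺, to
-- whichever of P₁, P₂ does not gain flow in N⁺.  Excluding these situations
-- leaves exactly the four cases, according to which of P₁, P₂ vanish in N⁺.
module Submission where

open import Defs
open import Data.Bool.Base using (true; false)
open import Data.Fin.Properties using () renaming (_≟_ to _≟ᶠ_)
open import Data.List.Base using (List; []; _∷_; map; filter)
open import Data.List.Membership.DecPropositional (_≟ᶠ_ {5}) using (_∈?_)
open import Data.List.Relation.Unary.All using (All; []; _∷_)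
import Data.List.Relation.Unary.All as All
open import Data.Product.Base using (_×_; _,_; proj₁; proj₂)
open import Data.Sum.Base using (_⊎_; inj₁; inj₂)
open import Relation.Binary.Bundles using (Poset)
open import Relation.Binary.PropositionalEquality.Core using (_≡_; refl; cong)
import Relation.Binary.Reasoning.PartialOrder as ≤-Reasoning
open import Relation.Binary.Structures using (IsDecTotalOrder)
open import Relation.Nullary.Decidable.Core using (yes; no; does)
open import Relation.Nullary.Negation.Core using (¬_; contradiction)
open import Relation.Unary using (Pred; Decidable)

module OrderedField {c ℓ₁ ℓ₂} (ℝ : RealNumbers c ℓ₁ ℓ₂) where

  open RealNumbers ℝ
  open IsDecTotalOrder isDecTotalOrder public
    using (_≟_; antisym; total)
    renaming (refl to ≤-refl; trans to ≤-trans; reflexive to ≤-reflexive)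

  poset : Poset c ℓ₁ ℓ₂
  poset = record { isPartialOrder = IsDecTotalOrder.isPartialOrder isDecTotalOrder }

  open ≤-Reasoning poset

  +-monoʳ-≤ : ∀ z {x y} → x ≤ y → z + x ≤ z + y
  +-monoʳ-≤ z {x} {y} x≤y = begin
    z + x  ≈⟨ +-comm z x ⟩
    x + z  ≤⟨ +-monoˡ-≤ z x≤y ⟩
    y + z  ≈⟨ +-comm y z ⟩
    z + y  ∎

  +-mono-≤ : ∀ {w x y z} → w ≤ x → y ≤ z → w + y ≤ x + z
  +-mono-≤ {x = x} {y} w≤x y≤z = ≤-trans (+-monoˡ-≤ y w≤x) (+-monoʳ-≤ x y≤z)

  x≤y+x : ∀ {x y} → 0# ≤ y → x ≤ y + x
  x≤y+x {x} {y} 0≤y = begin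
    x       ≈⟨ +-identityˡ x ⟨
    0# + x  ≤⟨ +-monoˡ-≤ x 0≤y ⟩
    y + x   ∎

  -x+[x+y]≈y : ∀ x y → - x + (x + y) ≈ y
  -x+[x+y]≈y x y = begin-equality
    - x + (x + y)  ≈⟨ +-assoc (- x) x y ⟨
    - x + x + y    ≈⟨ +-congʳ (-‿inverseˡ x) ⟩
    0# + y         ≈⟨ +-identityˡ y ⟩
    y              ∎

  +-cancelˡ-≤ : ∀ z {x y} → z + x ≤ z + y → x ≤ y
  +-cancelˡ-≤ z {x} {y} z+x≤z+y = begin
    x              ≈⟨ -x+[x+y]≈y z x ⟨
    - z + (z + x)  ≤⟨ +-monoʳ-≤ (- z) z+x≤z+y ⟩
    - z + (z + y)  ≈⟨ -x+[x+y]≈y z y ⟩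
    y              ∎

  -- The order axioms only speak of products of non-negative elements, so the gap `- x + y` is
  -- multiplied by `z` and added to `z * x`.
  *-monoʳ-≤ : ∀ z {x y} → 0# ≤ z → x ≤ y → z * x ≤ z * y
  *-monoʳ-≤ z {x} {y} 0≤z x≤y = begin
    z * x                      ≤⟨ x≤y+x (*-nonNeg 0≤z 0≤-x+y) ⟩
    z * (- x + y) + z * x      ≈⟨ distribˡ z (- x + y) x ⟨
    z * (- x + y + x)          ≈⟨ *-congˡ (+-comm (- x + y) x) ⟩
    z * (x + (- x + y))        ≈⟨ *-congˡ (+-assoc x (- x) y) ⟨
    z * (x + - x + y)          ≈⟨ *-congˡ (+-congʳ (-‿inverseʳ x)) ⟩
    z * (0# + y)               ≈⟨ *-congˡ (+-identityˡ y) ⟩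
    z * y                      ∎
    where
    0≤-x+y : 0# ≤ - x + y
    0≤-x+y = begin
      0#       ≈⟨ -‿inverseˡ x ⟨
      - x + x  ≤⟨ +-monoʳ-≤ (- x) x≤y ⟩
      - x + y  ∎

  -- When one total is split in two ways, a gain in the first share is paid for by the second. It
  -- turns a gain of `P₁` into a loss on `cd`.
  +-exchange-≤ : ∀ {w x y z} → w + x ≈ y + z → w ≤ y → z ≤ x
  +-exchange-≤ {w} {x} {y} {z} w+x≈y+z w≤y = +-cancelˡ-≤ y (begin
    y + z  ≈⟨ w+x≈y+z ⟨
    w + x  ≤⟨ +-monoˡ-≤ x w≤y ⟩
    y + x  ∎)

module Equilibria {c ℓ₁ ℓ₂} (ℝ : RealNumbers c ℓ₁ ℓ₂)
                  (α β : Link → RealNumbers.Carrier ℝ)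
                  (Q : RealNumbers.Carrier ℝ) where

  open RealNumbers ℝ hiding (refl)
  open OrderedField ℝ
  open Flows ℝ α β Q
  open ≤-Reasoning poset

  sum-map-mono : ∀ {a} {A : Set a} {g h : A → Carrier} {xs : List A} →
                 All (λ x → g x ≤ h x) xs → sum (map g xs) ≤ sum (map h xs)
  sum-map-mono []       = ≤-refl
  sum-map-mono (p ∷ ps) = +-mono-≤ p (sum-map-mono ps)

  sum-filter-≤ : ∀ {a p} {A : Set a} {P : Pred A p} (P? : Decidable P)
                 {g : A → Carrier} → (∀ x → 0# ≤ g x) → ∀ xs →
                 sum (map g (filter P? xs)) ≤ sum (map g xs)
  sum-filter-≤ P? 0≤g [] = ≤-refl
  sum-filter-≤ P? {g} 0≤g (x ∷ xs) with does (P? x)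
  ... | true  = +-monoʳ-≤ (g x) (sum-filter-≤ P? 0≤g xs)
  ... | false = ≤-trans (sum-filter-≤ P? 0≤g xs) (x≤y+x (0≤g x))

  -- A link flow is a subsum of the path flows, which are non-negative and add up to `Q`.
  linkFlow-≤-Q : ∀ {n} {f : PathFlows n} → IsFlow f → ∀ l → linkFlow f l ≤ Q
  linkFlow-≤-Q {n} flow l =
    ≤-trans (sum-filter-≤ (λ p → l ∈? links p) nonNeg (paths n))
            (≤-reflexive (IsFlow.total flow))
    where open IsFlow flow using (nonNeg)

  equilibriumTime-≤ : ∀ {n} {f : PathFlows n} {T} → IsEquilibrium f T →
                      ∀ p → T ≤ pathTime f p
  equilibriumTime-≤ {f = f} eq p with f p ≟ 0#
  ... | yes fp≈0 = IsEquilibrium.vanishing eq p fp≈0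
  ... | no  fp≉0 = ≤-reflexive (sym (IsEquilibrium.nonVanishing eq p fp≉0))

  module _ (0≤β : ∀ i → 0# ≤ β i) where

    linkTime-mono : ∀ {m n} {f : PathFlows m} {g : PathFlows n} {l} →
                    linkFlow f l ≤ linkFlow g l → linkTime f l ≤ linkTime g l
    linkTime-mono {l = l} f≤g = +-monoʳ-≤ (α l) (*-monoʳ-≤ (β l) (0≤β l) f≤g)

    -- The equilibrium time `S` bounds every path time in its network from below, while `T` equals
    -- the time of the used path `q`. The two paths may live in different networks, so they are
    -- matched through their lists of links.
    equilibriumTime-mono :
      ∀ {m n} {f : PathFlows m} {g : PathFlows n} {S T} →
      IsEquilibrium f S → IsEquilibrium g T →
      ∀ p q → links p ≡ links q → NonVanishing g q →
      All (λ l → linkFlow f l ≤ linkFlow g l) (links q) → S ≤ T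
    equilibriumTime-mono {f = f} {g} {S} {T} eqf eqg p q p≡q gq≉0 f≤g = begin
      S                                 ≤⟨ equilibriumTime-≤ eqf p ⟩
      sum (map (linkTime f) (links p))  ≡⟨ cong (λ ls → sum (map (linkTime f) ls)) p≡q ⟩
      sum (map (linkTime f) (links q))  ≤⟨ sum-map-mono (All.map (λ {l} → linkTime-mono {f = f} {g} {l}) f≤g) ⟩
      pathTime g q                      ≈⟨ IsEquilibrium.nonVanishing eqg q gq≉0 ⟩
      T                                 ∎

    module Paradox (0<Q : 0# < Q)
                   {f T} (eq : IsEquilibrium {N} f T)
                   {f⁺ T⁺} (eq⁺ : IsEquilibrium {N⁺} f⁺ T⁺)
                   (T<T⁺ : T < T⁺) where

      open IsFlow (IsEquilibrium.isFlow eq) using () renaming (total to total-f)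
      open IsFlow (IsEquilibrium.isFlow eq⁺)
        using () renaming (nonNeg to nonNeg⁺; total to total-f⁺)

      T⁺≰T : ¬ T⁺ ≤ T
      T⁺≰T T⁺≤T = T<T⁺ .proj₂ (antisym (T<T⁺ .proj₁) T⁺≤T)

      Q≉0 : ¬ Q ≈ 0#
      Q≉0 Q≈0 = 0<Q .proj₂ (sym Q≈0)

      saturated-≤ : ∀ l → linkFlow f l ≈ Q → linkFlow f⁺ l ≤ linkFlow f l
      saturated-≤ l fl≈Q = begin
        linkFlow f⁺ l  ≤⟨ linkFlow-≤-Q (IsEquilibrium.isFlow eq⁺) l ⟩
        Q              ≈⟨ fl≈Q ⟨
        linkFlow f l   ∎

      P₁-nonVanishing : NonVanishing f P₁
      P₁-nonVanishing f₁≈0 =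
        T⁺≰T (equilibriumTime-mono eq⁺ eq P₂ P₂ refl f₂≉0
               (saturated-≤ ac f₂≈Q ∷ saturated-≤ cd f₂≈Q ∷ []))
        where
        -- The trailing `0#` makes the left side the normal form of both `linkFlow f ac` and
        -- `linkFlow f cd`, as `saturated-≤` expects.
        f₂≈Q : f P₂ + 0# ≈ Q
        f₂≈Q = begin-equality
          f P₂ + 0#           ≈⟨ +-identityˡ _ ⟨
          0# + (f P₂ + 0#)    ≈⟨ +-congʳ f₁≈0 ⟨
          f P₁ + (f P₂ + 0#)  ≈⟨ total-f ⟩
          Q                   ∎

        f₂≉0 : NonVanishing f P₂
        f₂≉0 f₂≈0 = Q≉0 (trans (sym f₂≈Q) (trans (+-identityʳ _) f₂≈0))

      P₂-nonVanishing : NonVanishing f P₂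
      P₂-nonVanishing f₂≈0 =
        T⁺≰T (equilibriumTime-mono eq⁺ eq P₁ P₁ refl P₁-nonVanishing
               (saturated-≤ ab f₁≈Q ∷ saturated-≤ bd f₁≈Q ∷ []))
        where
        f₁≈Q : f P₁ + 0# ≈ Q
        f₁≈Q = begin-equality
          f P₁ + 0#           ≈⟨ +-congˡ (trans (+-identityʳ _) f₂≈0) ⟨
          f P₁ + (f P₂ + 0#)  ≈⟨ total-f ⟩
          Q                   ∎

      noVanishing : NoVanishing f
      noVanishing P₁ = P₁-nonVanishing
      noVanishing P₂ = P₂-nonVanishing

      P₃-nonVanishing : NonVanishing f⁺ P₃
      P₃-nonVanishing f⁺₃≈0 with total (f P₁) (f⁺ P₁)
      ... | inj₁ f₁≤f⁺₁ =
        T⁺≰T (equilibriumTime-mono eq⁺ eq P₂ P₂ refl P₂-nonVanishing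
               -- In `N` the links `ac` and `cd` carry the same flow, by computation, so the bound
               -- on `cd` also serves for `ac`.
               (≤-trans ac≤cd cd≤ ∷ cd≤ ∷ []))
        where
        ac≤cd : linkFlow f⁺ ac ≤ linkFlow f⁺ cd
        ac≤cd = +-monoʳ-≤ (f⁺ P₂) (x≤y+x (nonNeg⁺ P₃))

        cd≤ : linkFlow f⁺ cd ≤ linkFlow f cd
        -- In both networks the paths through `cd` are exactly those other than `P₁`, so its flow is
        -- the complement of the flow of `P₁` in `Q`.
        cd≤ = +-exchange-≤ (trans total-f (sym total-f⁺)) f₁≤f⁺₁
      ... | inj₂ f⁺₁≤f₁ =
        T⁺≰T (equilibriumTime-mono eq⁺ eq P₁ P₁ refl P₁-nonVanishing
               -- In `N⁺` the link `ab` also carries the flow of `P₃`; as this is zero, `ab` gains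
               -- nothing. The link `bd` carries `P₁` alone.
               (+-mono-≤ f⁺₁≤f₁ (≤-reflexive (trans (+-identityʳ _) f⁺₃≈0))
                 ∷ +-monoˡ-≤ 0# f⁺₁≤f₁ ∷ []))

      paradoxCases : (NoVanishing f × NoVanishing f⁺)
                   ⊎ (NoVanishing f × OnlyNonVanishing f⁺ P₃)
                   ⊎ (NoVanishing f × OnlyVanishing f⁺ P₁)
                   ⊎ (NoVanishing f × OnlyVanishing f⁺ P₂)
      -- Since `P₃` is used in `N⁺` and both paths are used in `N`, these two tests determine which
      -- of the four cases holds.
      paradoxCases with f⁺ P₁ ≟ 0# | f⁺ P₂ ≟ 0#
      ... | no  ≉₁ | no  ≉₂ = inj₁ (noVanishing , λ where
        P₁ → ≉₁
        P₂ → ≉₂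
        P₃ → P₃-nonVanishing)
      ... | yes ≈₁ | yes ≈₂ = inj₂ (inj₁ (noVanishing , P₃-nonVanishing , λ where
        P₁ ≉₁ → contradiction ≈₁ ≉₁
        P₂ ≉₂ → contradiction ≈₂ ≉₂
        P₃ _  → refl))
      ... | yes ≈₁ | no  ≉₂ = inj₂ (inj₂ (inj₁ (noVanishing , ≈₁ , λ where
        P₁ _  → refl
        P₂ ≈₂ → contradiction ≈₂ ≉₂
        P₃ ≈₃ → contradiction ≈₃ P₃-nonVanishing)))
      ... | no  ≉₁ | yes ≈₂ = inj₂ (inj₂ (inj₂ (noVanishing , ≈₂ , λ where
        P₁ ≈₁ → contradiction ≈₁ ≉₁
        P₂ _  → refl
        P₃ ≈₃ → contradiction ≈₃ P₃-nonVanishing)))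

mainTheorem1 : ∀ {c ℓ₁ ℓ₂} (ℝ : RealNumbers c ℓ₁ ℓ₂) →
    let open RealNumbers ℝ in
    (α β : Link → Carrier) (Q : Carrier) →
    let open Flows ℝ α β Q in
    (∀ i → 0# ≤ α i) → (∀ i → 0# < β i) → 0# < Q →
    (f : PathFlows N) (T : Carrier) → IsEquilibrium f T →
    (f⁺ : PathFlows N⁺) (T⁺ : Carrier) → IsEquilibrium f⁺ T⁺ →
    T < T⁺ →
    (NoVanishing f × NoVanishing f⁺)
    ⊎ (NoVanishing f × OnlyNonVanishing f⁺ P₃)
    ⊎ (NoVanishing f × OnlyVanishing f⁺ P₁)
    ⊎ (NoVanishing f × OnlyVanishing f⁺ P₂)
mainTheorem1 ℝ α β Q _ 0<β 0<Q f T eq f⁺ T⁺ eq⁺ T<T⁺ =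
  Equilibria.Paradox.paradoxCases ℝ α β Q (λ i → 0<β i .proj₁) 0<Q eq eq⁺ T<T⁺
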